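{- For every nonnegative integer $n$, $$\sum_{k=0}^{\infty}(-1)^k(4k+1)\,\frac{(-4n)_k\,(-n+\tfrac38)_k\,(\tfrac12)_k}{k!\,(n+\tfrac98)_k\,(4n+\tfrac32)_k}=\left(\frac{2^8}{5^5}\right)^n\frac{(\tfrac78)_n(\tfrac38)_n(\tfrac98)_n^2}{(\tfrac{33}{40})_n(\tfrac{41}{40})_n(\tfrac{9}{40})_n(\tfrac{17}{40})_n}.$$ (The sum is finite, since $(-4n)_k=0$ for $k>4n$.)
   Context: $(a)_j=\Gamma(a+j)/\Gamma(a)=a(a+1)\cdots(a+j-1)$ denotes the rising factorial (Pochhammer symbol), with $(a)_0=1$. -}

module Defs where

open import Data.Fin.Base using (toℕ)
open import Data.Integer.Base using (+_)
open import Data.Nat.Base as ℕ using (ℕ; zero; suc; _!)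
open import Data.Nat.Properties using (_!≢0)
open import Data.Rational.Base
open import Data.Rational.Literals using (fromℤ)
open import Data.Rational.Properties
open import Algebra.Definitions.RawMonoid +-0-rawMonoid using (sum)

infix 9 ι_

ι_ : ℕ → ℚ
ι n = fromℤ (+ n)

poch : ℚ → ℕ → ℚ
poch a zero    = 1ℚ
poch a (suc j) = poch a j * (a + ι j)

-- f 0 + … + f (N ∸ 1)
∑< : ℕ → (ℕ → ℚ) → ℚ
∑< N f = sum {N} (λ k → f (toℕ k))

poch-pos : ∀ a → .(Positive a) → ∀ k → Positive (poch a k)
poch-pos a a⁺ zero    = _
poch-pos a a⁺ (suc k) =
  pos*pos⇒pos (poch a k) {{poch-pos a a⁺ k}} (a + ι k) {{pos+nonNeg⇒pos a {{a⁺}} (ι k)}}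

ι+-pos : ∀ n a → .(Positive a) → Positive (ι n + a)
ι+-pos n a a⁺ = nonNeg+pos⇒pos (ι n) a {{a⁺}}

ι!-pos : ∀ k → Positive (ι (k !))
ι!-pos k with k ! | k !≢0
... | suc _ | _ = _

*-pos : ∀ p q → .(Positive p) → .(Positive q) → Positive (p * q)
*-pos p q p⁺ q⁺ = pos*pos⇒pos p {{p⁺}} q {{q⁺}}

summand-den≢0 : ∀ n k →
  NonZero (ι (k !) * poch (ι n + + 9 / 8) k * poch (ι (4 ℕ.* n) + + 3 / 2) k)
summand-den≢0 n k = pos⇒nonZero (a * b * c) {{abc⁺}}
  where
  a = ι (k !)
  b = poch (ι n + + 9 / 8) k
  c = poch (ι (4 ℕ.* n) + + 3 / 2) k

  b⁺ : Positive b
  b⁺ = poch-pos (ι n + + 9 / 8) (ι+-pos n (+ 9 / 8) _) k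

  c⁺ : Positive c
  c⁺ = poch-pos (ι (4 ℕ.* n) + + 3 / 2) (ι+-pos (4 ℕ.* n) (+ 3 / 2) _) k

  abc⁺ : Positive (a * b * c)
  abc⁺ = *-pos (a * b) c (*-pos a b (ι!-pos k) b⁺) c⁺

closed-den≢0 : ∀ n →
  NonZero (poch (+ 33 / 40) n * poch (+ 41 / 40) n * poch (+ 9 / 40) n * poch (+ 17 / 40) n)
closed-den≢0 n = pos⇒nonZero (a * b * c * d) {{abcd⁺}}
  where
  a = poch (+ 33 / 40) n
  b = poch (+ 41 / 40) n
  c = poch (+ 9 / 40) n
  d = poch (+ 17 / 40) n

  ab⁺ : Positive (a * b)
  ab⁺ = *-pos a b (poch-pos (+ 33 / 40) _ n) (poch-pos (+ 41 / 40) _ n)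

  abc⁺ : Positive (a * b * c)
  abc⁺ = *-pos (a * b) c ab⁺ (poch-pos (+ 9 / 40) _ n)

  abcd⁺ : Positive (a * b * c * d)
  abcd⁺ = *-pos (a * b * c) d abc⁺ (poch-pos (+ 17 / 40) _ n)

-- With a = 1/2, c = 3/8 − n and m = 4n the sum is, up to the factor 2, the very
-- well-poised series S(m) = Σ_k (a + 2k) u(m, k), where
--   u(m, k) = (−1)^k (−m)_k (c)_k (a)_k / (k! (d)_k (m+1+a)_k),  d = 1 + a − c.
-- A WZ certificate shows (m + d) S(m+1) = (m + 1 + a) S(m), hence
-- S(m) = (a)_{m+1} / (d)_m for every m. The closed form then follows from the
-- multiplication formulas for (3/2)_{4n} and for (9/8)_{5n} = (9/8)_n (n + 9/8)_{4n}.

module Submission where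

open import Defs
open import Data.Integer.Base as ℤ using (+_)
import Data.Integer.Properties as ℤ
open import Data.Nat.Base as ℕ using (ℕ; zero; suc; _!)
import Data.Nat.Properties as ℕ
open import Data.Sum.Base using (inj₁; inj₂)
open import Data.Rational.Base
open import Data.Rational.Literals using (fromℤ)
open import Data.Rational.Properties
open import Data.Rational.Solver using (module +-*-Solver)
import Data.Rational.Unnormalised.Base as ℚᵘ
import Data.Rational.Unnormalised.Properties as ℚᵘ
open import Algebra.Bundles using (CommutativeRing)
open import Algebra.Properties.CommutativeMonoid.Sum
  (CommutativeRing.+-commutativeMonoid +-*-commutativeRing) using (sum-cong-≗)
open import Algebra.Properties.Semiring.Sum (CommutativeRing.semiring +-*-commutativeRing)
  using (*-distribˡ-sum)
open import Algebra.Properties.CommutativeSemiring.Exp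
  (CommutativeRing.commutativeSemiring +-*-commutativeRing) using (^-distrib-*)
open import Data.Fin.Base using (toℕ)
open import Algebra.Definitions.RawSemiring +-*-rawSemiring using (_^_)
open import Relation.Binary.PropositionalEquality
open +-*-Solver

-- Embeddings into the rationals, cancellation, finite sums.

fromℤ-homo-+ : ∀ i j → fromℤ (i ℤ.+ j) ≡ fromℤ i + fromℤ j
fromℤ-homo-+ i j = toℚᵘ-injective (ℚᵘ.≃-trans
  (ℚᵘ.*≡* (cong (ℤ._* + 1) (sym (cong₂ ℤ._+_ (ℤ.*-identityʳ i) (ℤ.*-identityʳ j)))))
  (ℚᵘ.≃-sym (toℚᵘ-homo-+ (fromℤ i) (fromℤ j))))

fromℤ-homo-* : ∀ i j → fromℤ (i ℤ.* j) ≡ fromℤ i * fromℤ j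
fromℤ-homo-* i j = toℚᵘ-injective (ℚᵘ.≃-sym (toℚᵘ-homo-* (fromℤ i) (fromℤ j)))

ι-homo-+ : ∀ m n → ι (m ℕ.+ n) ≡ ι m + ι n
ι-homo-+ m n = fromℤ-homo-+ (+ m) (+ n)

ι-homo-* : ∀ m n → ι (m ℕ.* n) ≡ ι m * ι n
ι-homo-* m n = trans (cong fromℤ (ℤ.pos-* m n)) (fromℤ-homo-* (+ m) (+ n))

ι-suc : ∀ n → ι (suc n) ≡ 1ℚ + ι n
ι-suc n = ι-homo-+ 1 n

-- Identities between quotients are proved below by multiplying with a positive denominator and
-- cancelling it again here.
*-cancelʳ-≡-pos : ∀ {p q} r → .(Positive r) → p * r ≡ q * r → p ≡ q
*-cancelʳ-≡-pos r r⁺ eq = ≤-antisym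
  (*-cancelʳ-≤-pos r {{r⁺}} (≤-reflexive eq))
  (*-cancelʳ-≤-pos r {{r⁺}} (≤-reflexive (sym eq)))

÷-cancelʳ : ∀ p q .{{_ : NonZero q}} → p ÷ q * q ≡ p
÷-cancelʳ p q = trans (*-assoc p (1/ q) q)
  (trans (cong (p *_) (*-inverseˡ q)) (*-identityʳ p))

∑<-suc : ∀ N f → ∑< (suc N) f ≡ ∑< N f + f N
∑<-suc zero    f = trans (+-identityʳ (f 0)) (sym (+-identityˡ (f 0)))
∑<-suc (suc N) f = trans
  (cong (_+_ (f 0)) (∑<-suc N (λ k → f (suc k))))
  (sym (+-assoc (f 0) _ _))

-- Rising factorials.

-- The recursion of `poch` splits off the last factor; splitting off the first one relates bases
-- that differ by 1.
poch-shift : ∀ a k → a * poch (1ℚ + a) k ≡ poch a (suc k)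
poch-shift a zero    = solve 1 (λ a → a :* con 1ℚ := con 1ℚ :* (a :+ con 0ℚ)) refl a
poch-shift a (suc k) = trans (sym (*-assoc a _ _)) (cong₂ _*_ (poch-shift a k)
  (trans (solve 2 (λ a k → con 1ℚ :+ a :+ k := a :+ (con 1ℚ :+ k)) refl a (ι k))
         (cong (_+_ a) (sym (ι-suc k)))))

poch-+ : ∀ a m n → poch a (n ℕ.+ m) ≡ poch a m * poch (ι m + a) n
poch-+ a m zero    = sym (*-identityʳ _)
poch-+ a m (suc n) = trans (cong₂ _*_ (poch-+ a m n)
  (trans (cong (_+_ a) (ι-homo-+ n m))
         (solve 3 (λ a m n → a :+ (n :+ m) := m :+ a :+ n) refl a (ι m) (ι n))))
  (*-assoc (poch a m) _ _)

poch-vanishes : ∀ {m k} → m ℕ.< k → poch (- ι m) k ≡ 0ℚ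
poch-vanishes {m} {suc k} m<1+k with ℕ.m<1+n⇒m<n∨m≡n m<1+k
... | inj₁ m<k = trans (cong (_* (- ι m + ι k)) (poch-vanishes m<k)) (*-zeroˡ (- ι m + ι k))
... | inj₂ refl = trans (cong (poch (- ι m) m *_) (+-inverseˡ (ι m))) (*-zeroʳ (poch (- ι m) m))

-- The terminating very well-poised series.

-- In the application `c` and the upper index m both depend on n. They are independent here because
-- the recurrence in m keeps `c` fixed. Positivity of `a` and `d` makes every denominator positive;
-- `c` may have any sign.
module WellPoised
  (a c d : ℚ) (a⁺ : Positive a) (d⁺ : Positive d) (d≡ : d ≡ 1ℚ + a - c) where

  -- The well-poised partner of -m: the pairs `c`, `d` and -m, `β m` both have sum 1 + a.
  β : ℕ → ℚ
  β m = ι m + (1ℚ + a)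

  num den u : ℕ → ℕ → ℚ
  num m k = poch (- ι m) k * poch c k * poch a k
  den m k = ι (k !) * poch d k * poch (β m) k

  β⁺ : ∀ m → Positive (β m)
  β⁺ m = ι+-pos m (1ℚ + a) (pos+pos⇒pos 1ℚ a {{a⁺}})

  den⁺ : ∀ m k → Positive (den m k)
  den⁺ m k = *-pos (ι (k !) * poch d k) (poch (β m) k)
    (*-pos (ι (k !)) (poch d k) (ι!-pos k) (poch-pos d d⁺ k))
    (poch-pos (β m) (β⁺ m) k)

  den≢0 : ∀ m k → NonZero (den m k)
  den≢0 m k = pos⇒nonZero (den m k) {{den⁺ m k}}

  u m k = (- 1ℚ) ^ k * (_÷_ (num m k) (den m k) {{den≢0 m k}})

  u*den≡num : ∀ m k → u m k * den m k ≡ (- 1ℚ) ^ k * num m k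
  u*den≡num m k = trans (*-assoc ((- 1ℚ) ^ k) _ _)
    (cong ((- 1ℚ) ^ k *_) (÷-cancelʳ (num m k) (den m k) {{den≢0 m k}}))

  u-vanishes : ∀ {m k} → m ℕ.< k → u m k ≡ 0ℚ
  u-vanishes {m} {k} m<k rewrite poch-vanishes m<k =
    solve 4 (λ s p q r → s :* (con 0ℚ :* p :* q :* r) := con 0ℚ) refl
      ((- 1ℚ) ^ k) (poch c k) (poch a k) (1/_ (den m k) {{den≢0 m k}})

  β-suc : ∀ m → β (suc m) ≡ 1ℚ + β m
  β-suc m = trans (cong (_+ (1ℚ + a)) (ι-suc m)) (+-assoc 1ℚ (ι m) (1ℚ + a))

  ι-suc! : ∀ k → ι (suc k !) ≡ (1ℚ + ι k) * ι (k !)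
  ι-suc! k = trans (ι-homo-* (suc k) (k !)) (cong (_* ι (k !)) (ι-suc k))

  -- Every rising factorial gains its last factor, and the alternating sign turns -m + k into m - k.
  -- Both ratios of `u` are stated without division, so they stay valid where terms vanish.
  u-step-k : ∀ m k →
    u m (suc k) * ((1ℚ + ι k) * (d + ι k) * (β m + ι k)) ≡
    u m k * ((ι m - ι k) * (c + ι k) * (a + ι k))
  u-step-k m k = *-cancelʳ-≡-pos (den m k) (den⁺ m k) (begin
    v * ((1ℚ + y) * (d + y) * (β m + y)) * (K * D * E)
      ≡⟨ solve 7 (λ v y d b K D E →
           v :* ((con 1ℚ :+ y) :* (d :+ y) :* (b :+ y)) :* (K :* D :* E) :=
           v :* ((con 1ℚ :+ y) :* K :* (D :* (d :+ y)) :* (E :* (b :+ y))))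
         refl v y d (β m) K D E ⟩
    v * ((1ℚ + y) * K * (D * (d + y)) * (E * (β m + y)))
      ≡⟨ cong (λ f → v * (f * (D * (d + y)) * (E * (β m + y)))) (sym (ι-suc! k)) ⟩
    v * den m (suc k)
      ≡⟨ u*den≡num m (suc k) ⟩
    (- 1ℚ) * s * (P * (- ι m + y) * (C * (c + y)) * (A * (a + y)))
      ≡⟨ solve 8 (λ s P C A x y c a →
           (:- con 1ℚ) :* s :* (P :* (:- x :+ y) :* (C :* (c :+ y)) :* (A :* (a :+ y))) :=
           s :* (P :* C :* A) :* ((x :- y) :* (c :+ y) :* (a :+ y)))
         refl s P C A (ι m) y c a ⟩
    s * (P * C * A) * r
      ≡⟨ cong (_* r) (sym (u*den≡num m k)) ⟩
    u m k * (K * D * E) * r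
      ≡⟨ solve 3 (λ u D r → u :* D :* r := u :* r :* D) refl (u m k) (K * D * E) r ⟩
    u m k * r * (K * D * E) ∎)
    where
    open ≡-Reasoning
    v = u m (suc k)
    y = ι k
    K = ι (k !)
    D = poch d k
    E = poch (β m) k
    s = (- 1ℚ) ^ k
    P = poch (- ι m) k
    C = poch c k
    A = poch a k
    r = (ι m - y) * (c + y) * (a + y)

  -- The step is diagonal because raising m alone brings in 1/(m+1-k), whereas (-m-1)_{k+1} = -(m+1)
  -- (-m)_k has no pole.
  u-step-mk : ∀ m k →
    u (suc m) (suc k) * ((1ℚ + ι k) * (d + ι k) * (β m + ι k) * (1ℚ + β m + ι k)) ≡
    u m k * ((1ℚ + ι m) * β m * (c + ι k) * (a + ι k))
  u-step-mk m k = *-cancelʳ-≡-pos (den m k) (den⁺ m k) (begin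
    w * ((1ℚ + y) * (d + y) * (b + y) * (1ℚ + b + y)) * (K * D * E)
      ≡⟨ solve 7 (λ w y d b K D E →
           w :* ((con 1ℚ :+ y) :* (d :+ y) :* (b :+ y) :* (con 1ℚ :+ b :+ y)) :* (K :* D :* E) :=
           w :* ((con 1ℚ :+ y) :* K :* (D :* (d :+ y)) :* (E :* (b :+ y) :* (con 1ℚ :+ b :+ y))))
         refl w y d b K D E ⟩
    w * ((1ℚ + y) * K * (D * (d + y)) * (E * (b + y) * (1ℚ + b + y)))
      -- `den (suc m)` has base 1 + b instead of b. Since (b)_{k+1} = b (1+b)_k, the change of base
      -- leaves the factor b that appears in `r`.
      ≡⟨ cong₂ (λ f e → w * (f * (D * (d + y)) * (e * (1ℚ + b + y)))) (sym (ι-suc! k))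
           (sym (poch-shift b k)) ⟩
    w * (K′ * (D * (d + y)) * (b * poch (1ℚ + b) k * (1ℚ + b + y)))
      ≡⟨ cong (λ z → w * (K′ * (D * (d + y)) * (b * poch z k * (z + y)))) (sym (β-suc m)) ⟩
    w * (K′ * (D * (d + y)) * (b * E′ * (β (suc m) + y)))
      ≡⟨ solve 6 (λ w K D b E z → w :* (K :* D :* (b :* E :* z)) := w :* (K :* D :* (E :* z)) :* b)
         refl w K′ (D * (d + y)) b E′ (β (suc m) + y) ⟩
    w * den (suc m) (suc k) * b
      ≡⟨ cong (_* b) (u*den≡num (suc m) (suc k)) ⟩
    (- 1ℚ) * s * (poch (- ι (suc m)) (suc k) * (C * (c + y)) * (A * (a + y))) * b
      ≡⟨ cong (λ p → (- 1ℚ) * s * (p * (C * (c + y)) * (A * (a + y))) * b) P′≡ ⟩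
    (- 1ℚ) * s * (- (1ℚ + x) * P * (C * (c + y)) * (A * (a + y))) * b
      ≡⟨ solve 9 (λ s P C A x y c a b →
           (:- con 1ℚ) :* s :* (:- (con 1ℚ :+ x) :* P :* (C :* (c :+ y)) :* (A :* (a :+ y))) :* b :=
           s :* (P :* C :* A) :* ((con 1ℚ :+ x) :* b :* (c :+ y) :* (a :+ y)))
         refl s P C A x y c a b ⟩
    s * (P * C * A) * r
      ≡⟨ cong (_* r) (sym (u*den≡num m k)) ⟩
    u m k * (K * D * E) * r
      ≡⟨ solve 3 (λ u D r → u :* D :* r := u :* r :* D) refl (u m k) (K * D * E) r ⟩
    u m k * r * (K * D * E) ∎)
    where
    open ≡-Reasoning
    w = u (suc m) (suc k)
    x = ι m
    y = ι k
    b = β m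
    K = ι (k !)
    K′ = ι (suc k !)
    D = poch d k
    E = poch b k
    E′ = poch (β (suc m)) k
    s = (- 1ℚ) ^ k
    P = poch (- x) k
    C = poch c k
    A = poch a k
    r = (1ℚ + x) * b * (c + y) * (a + y)
    P′≡ : poch (- ι (suc m)) (suc k) ≡ - (1ℚ + x) * P
    P′≡ = trans (sym (poch-shift (- ι (suc m)) k))
      (trans (cong (λ z → - z * poch (1ℚ - z) k) (ι-suc m))
        (cong (λ z → - (1ℚ + x) * poch z k)
          (solve 1 (λ x → con 1ℚ :- (con 1ℚ :+ x) := :- x) refl x)))

  term : ℕ → ℕ → ℚ
  term m k = (a + ι k + ι k) * u m k

  -- The cutoff `N` is separate from m because the certificate speaks of partial sums; every `N`
  -- above m gives the full sum.
  S : ℕ → ℕ → ℚ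
  S N m = ∑< N (term m)


  S-one : ∀ m → S 1 m ≡ a
  -- `u m 0` evaluates to 1.
  S-one m = solve 1 (λ a → (a :+ con 0ℚ :+ con 0ℚ) :* con 1ℚ :+ con 0ℚ := a) refl a

  -- The right-hand side divided by β m + ι k is the WZ certificate G(m, k+1). Expressed
  -- through u(m, k) it has no factor 1/(m+1−k), hence no pole at k = m + 1.
  wz : ∀ m k →
    (S (suc k) (suc m) * (ι m + d) - S (suc k) m * β m) * (β m + ι k) ≡
    - (β m * u m k * (c + ι k) * (a + ι k))
  wz m zero = begin
    (S 1 (suc m) * (x + d) - S 1 m * β m) * (β m + 0ℚ)
      ≡⟨ cong₂ (λ p q → (p * (x + d) - q * β m) * (β m + 0ℚ)) (S-one (suc m)) (S-one m) ⟩
    (a * (x + d) - a * β m) * (β m + 0ℚ)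
      -- The well-poised relation turns x + d - β m into -c, which supplies the factor c on the
      -- right.
      ≡⟨ cong (λ z → (a * (x + z) - a * β m) * (β m + 0ℚ)) d≡ ⟩
    (a * (x + (1ℚ + a - c)) - a * β m) * (β m + 0ℚ)
      ≡⟨ solve 3 (λ a c x → let b = x :+ (con 1ℚ :+ a) in
           (a :* (x :+ (con 1ℚ :+ a :- c)) :- a :* b) :* (b :+ con 0ℚ) :=
           :- (b :* con 1ℚ :* (c :+ con 0ℚ) :* (a :+ con 0ℚ))) refl a c x ⟩
    - (β m * 1ℚ * (c + 0ℚ) * (a + 0ℚ)) ∎
    where
    open ≡-Reasoning
    x = ι m
  -- `M` clears the ratio of v to `u m k`. The ratio of w to `u m k` needs one more factor 1 + b +
  -- y, already present as b + ι (suc k).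
  wz m (suc k) = *-cancelʳ-≡-pos M M⁺ (begin
    (S (suc (suc k)) (suc m) * (x + d) - S (suc (suc k)) m * b) * (b + ι (suc k)) * M
      ≡⟨ cong₂ (λ p q → (p * (x + d) - q * b) * (b + ι (suc k)) * M)
           (∑<-suc (suc k) (term (suc m))) (∑<-suc (suc k) (term m)) ⟩
    ((S₁ + (a + ι (suc k) + ι (suc k)) * w) * (x + d) -
     (S₀ + (a + ι (suc k) + ι (suc k)) * v) * b) * (b + ι (suc k)) * M
      ≡⟨ cong (λ z → ((S₁ + (a + z + z) * w) * (x + d) - (S₀ + (a + z + z) * v) * b) * (b + z) * M)
           (ι-suc k) ⟩
    ((S₁ + t * w) * (x + d) - (S₀ + t * v) * b) * (b + (1ℚ + y)) * M
      -- The three summands now contain the left sides of `wz m k`, `u-step-mk m k` and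
      -- `u-step-k m k`.
      ≡⟨ solve 9 (λ S₁ S₀ t v w x y d b →
           ((S₁ :+ t :* w) :* (x :+ d) :- (S₀ :+ t :* v) :* b) :* (b :+ (con 1ℚ :+ y)) :*
             ((con 1ℚ :+ y) :* (d :+ y) :* (b :+ y)) :=
           (S₁ :* (x :+ d) :- S₀ :* b) :* (b :+ y) :* ((b :+ (con 1ℚ :+ y)) :* ((con 1ℚ :+ y) :* (d :+ y)))
           :+ w :* ((con 1ℚ :+ y) :* (d :+ y) :* (b :+ y) :* (con 1ℚ :+ b :+ y)) :* (t :* (x :+ d))
           :- v :* ((con 1ℚ :+ y) :* (d :+ y) :* (b :+ y)) :* (t :* b :* (b :+ (con 1ℚ :+ y))))
         refl S₁ S₀ t v w x y d b ⟩
    (S₁ * (x + d) - S₀ * b) * (b + y) * ((b + (1ℚ + y)) * ((1ℚ + y) * (d + y)))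
    + w * (M * (1ℚ + b + y)) * (t * (x + d))
    - v * M * (t * b * (b + (1ℚ + y)))
      ≡⟨ cong₂ (λ p q →
           p * ((b + (1ℚ + y)) * ((1ℚ + y) * (d + y))) + q * (t * (x + d))
           - v * M * (t * b * (b + (1ℚ + y))))
         (wz m k) (u-step-mk m k) ⟩
    - (b * u m k * (c + y) * (a + y)) * ((b + (1ℚ + y)) * ((1ℚ + y) * (d + y)))
    + u m k * ((1ℚ + x) * b * (c + y) * (a + y)) * (t * (x + d))
    - v * M * (t * b * (b + (1ℚ + y)))
      ≡⟨ cong (λ p →
           - (b * u m k * (c + y) * (a + y)) * ((b + (1ℚ + y)) * ((1ℚ + y) * (d + y)))
           + u m k * ((1ℚ + x) * b * (c + y) * (a + y)) * (t * (x + d))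
           - p * (t * b * (b + (1ℚ + y)))) (u-step-k m k) ⟩
    - (b * u m k * (c + y) * (a + y)) * ((b + (1ℚ + y)) * ((1ℚ + y) * (d + y)))
    + u m k * ((1ℚ + x) * b * (c + y) * (a + y)) * (t * (x + d))
    - u m k * ((x - y) * (c + y) * (a + y)) * (t * b * (b + (1ℚ + y)))
      ≡⟨ identity d≡ ⟩
    - (b * (u m k * ((x - y) * (c + y) * (a + y))) * (c + (1ℚ + y)) * (a + (1ℚ + y)))
      ≡⟨ cong (λ p → - (b * p * (c + (1ℚ + y)) * (a + (1ℚ + y)))) (sym (u-step-k m k)) ⟩
    - (b * (v * M) * (c + (1ℚ + y)) * (a + (1ℚ + y)))
      ≡⟨ solve 5 (λ b v M p q → :- (b :* (v :* M) :* p :* q) := :- (b :* v :* p :* q) :* M)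
         refl b v M (c + (1ℚ + y)) (a + (1ℚ + y)) ⟩
    - (b * v * (c + (1ℚ + y)) * (a + (1ℚ + y))) * M
      ≡⟨ cong (λ z → - (b * v * (c + z) * (a + z)) * M) (sym (ι-suc k)) ⟩
    - (b * v * (c + ι (suc k)) * (a + ι (suc k))) * M ∎)
    where
    open ≡-Reasoning
    x = ι m
    y = ι k
    b = β m
    t = a + (1ℚ + y) + (1ℚ + y)
    v = u m (suc k)
    w = u (suc m) (suc k)
    S₁ = S (suc k) (suc m)
    S₀ = S (suc k) m
    M = (1ℚ + y) * (d + y) * (b + y)

    M⁺ : Positive M
    M⁺ = *-pos ((1ℚ + y) * (d + y)) (b + y)
      (*-pos (1ℚ + y) (d + y) (pos+nonNeg⇒pos 1ℚ y) (pos+nonNeg⇒pos d {{d⁺}} y))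
      (pos+nonNeg⇒pos b {{β⁺ m}} y)

    -- The bound `d` shadows the parameter, so `refl` substitutes 1 + a - c in the visible factors
    -- while `u m k` stays opaque. After the common factor b u (c+y) (a+y) is taken out, a
    -- polynomial identity in a, c, x, y remains.
    identity : ∀ {d} → d ≡ 1ℚ + a - c →
      - (b * u m k * (c + y) * (a + y)) * ((b + (1ℚ + y)) * ((1ℚ + y) * (d + y)))
      + u m k * ((1ℚ + x) * b * (c + y) * (a + y)) * (t * (x + d))
      - u m k * ((x - y) * (c + y) * (a + y)) * (t * b * (b + (1ℚ + y))) ≡
      - (b * (u m k * ((x - y) * (c + y) * (a + y))) * (c + (1ℚ + y)) * (a + (1ℚ + y)))
    identity refl = trans
      (solve 8 (λ b u c a x y t d →
         :- (b :* u :* (c :+ y) :* (a :+ y)) :* ((b :+ (con 1ℚ :+ y)) :* ((con 1ℚ :+ y) :* (d :+ y)))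
         :+ u :* ((con 1ℚ :+ x) :* b :* (c :+ y) :* (a :+ y)) :* (t :* (x :+ d))
         :- u :* ((x :- y) :* (c :+ y) :* (a :+ y)) :* (t :* b :* (b :+ (con 1ℚ :+ y))) :=
         b :* u :* (c :+ y) :* (a :+ y) :*
         (:- ((b :+ (con 1ℚ :+ y)) :* ((con 1ℚ :+ y) :* (d :+ y)))
          :+ (con 1ℚ :+ x) :* (t :* (x :+ d)) :- (x :- y) :* (t :* (b :+ (con 1ℚ :+ y)))))
       refl b (u m k) c a x y t (1ℚ + a - c))
      (trans
        (cong (b * u m k * (c + y) * (a + y) *_)
          (solve 4 (λ a c x y →
             let b = x :+ (con 1ℚ :+ a)
                 t = a :+ (con 1ℚ :+ y) :+ (con 1ℚ :+ y)
                 d = con 1ℚ :+ a :- c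
             in :- ((b :+ (con 1ℚ :+ y)) :* ((con 1ℚ :+ y) :* (d :+ y)))
                :+ (con 1ℚ :+ x) :* (t :* (x :+ d)) :- (x :- y) :* (t :* (b :+ (con 1ℚ :+ y))) :=
                :- ((x :- y) :* (c :+ (con 1ℚ :+ y)) :* (a :+ (con 1ℚ :+ y))))
           refl a c x y))
        (solve 7 (λ b u p q r s t →
           b :* u :* p :* q :* (:- (s :* t :* r)) := :- (b :* (u :* (s :* p :* q)) :* t :* r))
         refl b (u m k) (c + y) (a + y) (a + (1ℚ + y)) (x - y) (c + (1ℚ + y))))

  S-zero : ∀ N → S (suc N) 0 ≡ a
  S-zero zero    = S-one 0
  S-zero (suc N) = trans (∑<-suc (suc N) (term 0))
    (trans (cong₂ (λ p q → p + (a + ι (suc N) + ι (suc N)) * q)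
                  (S-zero N) (u-vanishes {0} {suc N} (ℕ.s≤s ℕ.z≤n)))
           (solve 2 (λ a p → a :+ p :* con 0ℚ := a) refl a (a + ι (suc N) + ι (suc N))))

  -- For k = N - 1 the bound gives m < k, so `u m k` vanishes and with it the right side of
  -- `wz m k`; the positive factor `β m + ι k` then cancels.
  S-step : ∀ {N m} → suc m ℕ.< N → S N (suc m) * (ι m + d) ≡ S N m * β m
  S-step {suc k} {m} (ℕ.s≤s m<k) = begin
    p
      ≡⟨ solve 2 (λ p q → p := p :- q :+ q) refl p q ⟩
    p - q + q
      ≡⟨ cong (_+ q) (*-cancelʳ-≡-pos {p - q} {0ℚ} (b + y)
           (pos+nonNeg⇒pos b {{β⁺ m}} y) p-q≡0) ⟩
    0ℚ + q
      ≡⟨ +-identityˡ q ⟩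
    q ∎
    where
    open ≡-Reasoning
    b = β m
    y = ι k
    p = S (suc k) (suc m) * (ι m + d)
    q = S (suc k) m * b
    p-q≡0 : (p - q) * (b + y) ≡ 0ℚ * (b + y)
    p-q≡0 = trans (wz m k) (trans
      (cong (λ z → - (b * z * (c + y) * (a + y))) (u-vanishes m<k))
      (solve 4 (λ b p q z → :- (b :* con 0ℚ :* p :* q) := con 0ℚ :* z) refl
         b (c + y) (a + y) (b + y)))

  -- `S-step` telescopes down to `S-zero`, whose value a is the first factor of `poch a (suc m)`.
  -- One cutoff serves all smaller m.
  S-closed : ∀ {N} m → m ℕ.< N → S N m * poch d m ≡ poch a (suc m)
  S-closed {suc N} zero _ = trans (cong (_* 1ℚ) (S-zero N))
    (solve 1 (λ a → a :* con 1ℚ := con 1ℚ :* (a :+ con 0ℚ)) refl a)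
  S-closed {N} (suc m) 1+m<N = begin
    S N (suc m) * (poch d m * (d + ι m))
      ≡⟨ solve 4 (λ s p d x → s :* (p :* (d :+ x)) := s :* (x :+ d) :* p) refl
           (S N (suc m)) (poch d m) d (ι m) ⟩
    S N (suc m) * (ι m + d) * poch d m
      ≡⟨ cong (_* poch d m) (S-step 1+m<N) ⟩
    S N m * β m * poch d m
      ≡⟨ solve 3 (λ s b p → s :* b :* p := s :* p :* b) refl (S N m) (β m) (poch d m) ⟩
    S N m * poch d m * β m
      -- `β m` is a + (m + 1), the next factor of the rising factorial of a.
      ≡⟨ cong₂ _*_ (S-closed m (ℕ.<-trans (ℕ.n<1+n m) 1+m<N))
           (trans (solve 2 (λ x a → x :+ (con 1ℚ :+ a) := a :+ (con 1ℚ :+ x)) refl (ι m) a)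
                  (cong (_+_ a) (sym (ι-suc m)))) ⟩
    poch a (suc m) * (a + ι (suc m)) ∎
    where open ≡-Reasoning

-- Multiplication formulas for rising factorials.

-- The factors are sorted by residue modulo 4: 4x + 4y + j = 4 (x + y + j/4), and each block of four
-- contributes 4^4 = 256.
poch-quadruple : ∀ x n → poch (ι 4 * x) (4 ℕ.* n) ≡
  ι 256 ^ n * (poch x n * poch (+ 1 / 4 + x) n * poch (+ 1 / 2 + x) n * poch (+ 3 / 4 + x) n)
poch-quadruple x zero    = refl
poch-quadruple x (suc n) = begin
  poch (ι 4 * x) (4 ℕ.* suc n)
    ≡⟨ cong (poch (ι 4 * x)) (ℕ.*-suc 4 n) ⟩
  poch (ι 4 * x) (4 ℕ.+ 4 ℕ.* n)
    ≡⟨ poch-+ (ι 4 * x) (4 ℕ.* n) 4 ⟩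
  poch (ι 4 * x) (4 ℕ.* n) * poch (ι (4 ℕ.* n) + ι 4 * x) 4
    ≡⟨ cong₂ _*_ (poch-quadruple x n) (trans (cong (λ z → poch (z + ι 4 * x) 4) (ι-homo-* 4 n))
        (solve 2 (λ x y → let z = con (ι 4) :* y :+ con (ι 4) :* x in
           con 1ℚ :* (z :+ con 0ℚ) :* (z :+ con 1ℚ) :* (z :+ con (ι 2)) :* (z :+ con (ι 3)) :=
           con (ι 256) :* (x :+ y) :* (con (+ 1 / 4) :+ x :+ y) :* (con (+ 1 / 2) :+ x :+ y) :*
             (con (+ 3 / 4) :+ x :+ y)) refl x (ι n))) ⟩
  ι 256 ^ n * (A * B * C * D) * (ι 256 * a * b * c * d)
    ≡⟨ solve 10 (λ q A B C D r a b c d →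
         q :* (A :* B :* C :* D) :* (r :* a :* b :* c :* d) :=
         r :* q :* (A :* a :* (B :* b) :* (C :* c) :* (D :* d)))
       refl (ι 256 ^ n) A B C D (ι 256) a b c d ⟩
  ι 256 ^ suc n * (A * a * (B * b) * (C * c) * (D * d)) ∎
  where
  open ≡-Reasoning
  A = poch x n
  B = poch (+ 1 / 4 + x) n
  C = poch (+ 1 / 2 + x) n
  D = poch (+ 3 / 4 + x) n
  a = x + ι n
  b = + 1 / 4 + x + ι n
  c = + 1 / 2 + x + ι n
  d = + 3 / 4 + x + ι n

-- The same with residues modulo 5; each block contributes 5^5 = 3125.
poch-quintuple : ∀ x n → poch (ι 5 * x) (5 ℕ.* n) ≡
  ι 3125 ^ n * (poch x n * poch (+ 1 / 5 + x) n * poch (+ 2 / 5 + x) n *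
                poch (+ 3 / 5 + x) n * poch (+ 4 / 5 + x) n)
poch-quintuple x zero    = refl
poch-quintuple x (suc n) = begin
  poch (ι 5 * x) (5 ℕ.* suc n)
    ≡⟨ cong (poch (ι 5 * x)) (ℕ.*-suc 5 n) ⟩
  poch (ι 5 * x) (5 ℕ.+ 5 ℕ.* n)
    ≡⟨ poch-+ (ι 5 * x) (5 ℕ.* n) 5 ⟩
  poch (ι 5 * x) (5 ℕ.* n) * poch (ι (5 ℕ.* n) + ι 5 * x) 5
    ≡⟨ cong₂ _*_ (poch-quintuple x n) (trans (cong (λ z → poch (z + ι 5 * x) 5) (ι-homo-* 5 n))
        (solve 2 (λ x y → let z = con (ι 5) :* y :+ con (ι 5) :* x in
           con 1ℚ :* (z :+ con 0ℚ) :* (z :+ con 1ℚ) :* (z :+ con (ι 2)) :* (z :+ con (ι 3)) :*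
             (z :+ con (ι 4)) :=
           con (ι 3125) :* (x :+ y) :* (con (+ 1 / 5) :+ x :+ y) :* (con (+ 2 / 5) :+ x :+ y) :*
             (con (+ 3 / 5) :+ x :+ y) :* (con (+ 4 / 5) :+ x :+ y)) refl x (ι n))) ⟩
  ι 3125 ^ n * (A * B * C * D * E) * (ι 3125 * a * b * c * d * e)
    ≡⟨ solve 12 (λ q A B C D E r a b c d e →
         q :* (A :* B :* C :* D :* E) :* (r :* a :* b :* c :* d :* e) :=
         r :* q :* (A :* a :* (B :* b) :* (C :* c) :* (D :* d) :* (E :* e)))
       refl (ι 3125 ^ n) A B C D E (ι 3125) a b c d e ⟩
  ι 3125 ^ suc n * (A * a * (B * b) * (C * c) * (D * d) * (E * e)) ∎
  where
  open ≡-Reasoning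
  A = poch x n
  B = poch (+ 1 / 5 + x) n
  C = poch (+ 2 / 5 + x) n
  D = poch (+ 3 / 5 + x) n
  E = poch (+ 4 / 5 + x) n
  a = x + ι n
  b = + 1 / 5 + x + ι n
  c = + 2 / 5 + x + ι n
  d = + 3 / 5 + x + ι n
  e = + 4 / 5 + x + ι n

-- Evaluation of the closed form.

closedForm : ℕ → ℚ
closedForm n = (+ (2 ℕ.^ 8) / (5 ℕ.^ 5)) ^ n *
  _÷_ (poch (+ 7 / 8) n * poch (+ 3 / 8) n * poch (+ 9 / 8) n ^ 2)
      (poch (+ 33 / 40) n * poch (+ 41 / 40) n * poch (+ 9 / 40) n * poch (+ 17 / 40) n)
      {{closed-den≢0 n}}

-- The multiplication formulas apply with 3/2 = 4 · 3/8 and 9/8 = 5 · 9/40. Both produce (5/8)_n,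
-- which therefore cancels. One factor (9/8)_n comes from (3/2)_{4n}, the other from completing (n +
-- 9/8)_{4n} to (9/8)_{5n}; hence the square.
closedForm-ratio : ∀ n →
  closedForm n * poch (ι n + + 9 / 8) (4 ℕ.* n) ≡ poch (+ 3 / 2) (4 ℕ.* n)
-- `Z` removes the quotient, and `H` completes `P` to (9/8)_{5n}.
closedForm-ratio n = *-cancelʳ-≡-pos (Z * H) (*-pos Z H Z⁺ H⁺) (begin
  q ^ n * X * P * (Z * H)
    ≡⟨ solve 5 (λ q X P Z H → q :* X :* P :* (Z :* H) := q :* (X :* Z) :* (H :* P)) refl
         (q ^ n) X P Z H ⟩
  q ^ n * (X * Z) * (H * P)
    ≡⟨ cong₂ (λ s t → q ^ n * s * t) (÷-cancelʳ (p₇ * p₃ * (H * (H * 1ℚ))) Z {{closed-den≢0 n}})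
         (trans (sym (poch-+ (+ 9 / 8) n (4 ℕ.* n)))
           (trans (cong (poch (+ 9 / 8)) (ℕ.+-comm (4 ℕ.* n) n)) (poch-quintuple (+ 9 / 40) n))) ⟩
  q ^ n * (p₇ * p₃ * (H * (H * 1ℚ))) * (ι 3125 ^ n * (z₃ * z₄ * p₅ * z₁ * z₂))
    ≡⟨ solve 10 (λ q r p₃ p₅ p₇ H z₁ z₂ z₃ z₄ →
         q :* (p₇ :* p₃ :* (H :* (H :* con 1ℚ))) :* (r :* (z₃ :* z₄ :* p₅ :* z₁ :* z₂)) :=
         q :* r :* (p₃ :* p₅ :* p₇ :* H) :* (z₁ :* z₂ :* z₃ :* z₄ :* H))
       refl (q ^ n) (ι 3125 ^ n) p₃ p₅ p₇ H z₁ z₂ z₃ z₄ ⟩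
  q ^ n * ι 3125 ^ n * (p₃ * p₅ * p₇ * H) * (Z * H)
    -- The product of q and 3125 evaluates to 256.
    ≡⟨ cong (λ z → z * (p₃ * p₅ * p₇ * H) * (Z * H)) (sym (^-distrib-* q (ι 3125) n)) ⟩
  ι 256 ^ n * (p₃ * p₅ * p₇ * H) * (Z * H)
    ≡⟨ cong (_* (Z * H)) (sym (poch-quadruple (+ 3 / 8) n)) ⟩
  poch (+ 3 / 2) (4 ℕ.* n) * (Z * H) ∎)
  where
  open ≡-Reasoning
  q = + (2 ℕ.^ 8) / (5 ℕ.^ 5)
  p₃ = poch (+ 3 / 8) n
  p₅ = poch (+ 5 / 8) n
  p₇ = poch (+ 7 / 8) n
  H = poch (+ 9 / 8) n
  z₁ = poch (+ 33 / 40) n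
  z₂ = poch (+ 41 / 40) n
  z₃ = poch (+ 9 / 40) n
  z₄ = poch (+ 17 / 40) n
  Z = z₁ * z₂ * z₃ * z₄
  X = _÷_ (p₇ * p₃ * (H * (H * 1ℚ))) Z {{closed-den≢0 n}}
  P = poch (ι n + + 9 / 8) (4 ℕ.* n)
  H⁺ : Positive H
  H⁺ = poch-pos (+ 9 / 8) _ n
  Z⁺ : Positive Z
  Z⁺ = *-pos (z₁ * z₂ * z₃) z₄
    (*-pos (z₁ * z₂) z₃
      (*-pos z₁ z₂ (poch-pos (+ 33 / 40) _ n) (poch-pos (+ 41 / 40) _ n))
      (poch-pos (+ 9 / 40) _ n))
    (poch-pos (+ 17 / 40) _ n)

-- The infinite series is encoded by all its partial sums with cutoff `N` above 4n, where the terms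
-- have become zero.
theorem8 : ∀ (n N : ℕ) → 4 ℕ.* n ℕ.< N →
    ∑< N (λ k → (- 1ℚ) ^ k * ι (4 ℕ.* k ℕ.+ 1) *
    _÷_ (poch (- ι (4 ℕ.* n)) k * poch (- ι n + + 3 / 8) k * poch (+ 1 / 2) k)
    (ι (k !) * poch (ι n + + 9 / 8) k * poch (ι (4 ℕ.* n) + + 3 / 2) k)
    {{summand-den≢0 n k}})
    ≡ (+ (2 ℕ.^ 8) / (5 ℕ.^ 5)) ^ n *
    _÷_ (poch (+ 7 / 8) n * poch (+ 3 / 8) n * poch (+ 9 / 8) n ^ 2)
    (poch (+ 33 / 40) n * poch (+ 41 / 40) n * poch (+ 9 / 40) n * poch (+ 17 / 40) n)
    {{closed-den≢0 n}}
theorem8 n N 4n<N = *-cancelʳ-≡-pos P (poch-pos d d⁺ (4 ℕ.* n)) (begin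
  ∑< N summand * P
    ≡⟨ cong (_* P) (sum-cong-≗ {N} (λ i → summand≡ (toℕ i))) ⟩
  ∑< N (λ k → ι 2 * term (4 ℕ.* n) k) * P
    ≡⟨ cong (_* P) (sym (*-distribˡ-sum {N} (ι 2) (λ i → term (4 ℕ.* n) (toℕ i)))) ⟩
  ι 2 * S N (4 ℕ.* n) * P
    ≡⟨ *-assoc (ι 2) (S N (4 ℕ.* n)) P ⟩
  ι 2 * (S N (4 ℕ.* n) * P)
    -- (1/2)_{4n+1} = 1/2 (3/2)_{4n}; the 1/2 absorbs the factor 2 from 4k + 1 = 2 (1/2 + 2k).
    ≡⟨ cong (_*_ (ι 2)) (trans (S-closed (4 ℕ.* n) 4n<N) (sym (poch-shift ½ (4 ℕ.* n)))) ⟩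
  ι 2 * (½ * poch (+ 3 / 2) (4 ℕ.* n))
    ≡⟨ solve 1 (λ p → con (ι 2) :* (con ½ :* p) := p) refl (poch (+ 3 / 2) (4 ℕ.* n)) ⟩
  poch (+ 3 / 2) (4 ℕ.* n)
    ≡⟨ sym (closedForm-ratio n) ⟩
  closedForm n * P ∎)
  where
  open ≡-Reasoning
  d = ι n + + 9 / 8
  d⁺ : Positive d
  d⁺ = ι+-pos n (+ 9 / 8) _
  P = poch d (4 ℕ.* n)
  open WellPoised ½ (- ι n + + 3 / 8) d _ d⁺
    (solve 1 (λ x → x :+ con (+ 9 / 8) := con (+ 3 / 2) :- (:- x :+ con (+ 3 / 8))) refl (ι n))

  -- Since 1 + 1/2 evaluates to 3/2, `num` and `den` are by computation the numerator and
  -- denominator of the statement. The proofs that `den` is nonzero are irrelevant, so this quotient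
  -- agrees with the one in `u`.
  summand : ℕ → ℚ
  summand k =
    (- 1ℚ) ^ k * ι (4 ℕ.* k ℕ.+ 1) *
    _÷_ (num (4 ℕ.* n) k) (den (4 ℕ.* n) k) {{summand-den≢0 n k}}

  summand≡ : ∀ k → summand k ≡ ι 2 * term (4 ℕ.* n) k
  summand≡ k = trans
    (cong (λ z → s * z * x) (trans (ι-homo-+ (4 ℕ.* k) 1) (cong (_+ 1ℚ) (ι-homo-* 4 k))))
    (solve 3 (λ s y x → s :* (con (ι 4) :* y :+ con 1ℚ) :* x :=
       con (ι 2) :* ((con ½ :+ y :+ y) :* (s :* x))) refl s (ι k) x)
    where
    s = (- 1ℚ) ^ k
    x = _÷_ (num (4 ℕ.* n) k) (den (4 ℕ.* n) k) {{summand-den≢0 n k}}
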